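{- Suppose $P\in St_{2^k}$ is a standard tableau, where $k\ge 2$. Then $full_n^P=1$ for all $n\ge 1$ if and only if $P$ is degenerate.
   Context: $\mathcal{F}_{n,k}$ is the set of all fillings $F$ of the $k\times n$ rectangular array ($k$ rows, $n$ columns) with the integers $1,\dots,kn$, each used once, such that the elements in each column increase from bottom to top. $F(i,j)$ is the entry in the $i$-th row from the bottom and $j$-th column from the left. $St_{2^k}$ is the set of standard tableaux of shape $2^k$, i.e. elements of $\mathcal{F}_{2,k}$ whose entries also increase in each row from left to right. For a filling by distinct positive integers, $\mathrm{red}$ replaces the $i$-th smallest entry by $i$. For $P\in\mathcal{F}_{2,k}$, $F\in\mathcal{F}_{n,k}$ has a $P$-match starting at position $i$ ($1\le i\le n-1$) if the reduction of the $k\times 2$ filling formed by columns $i,i+1$ of $F$ equals $P$. $full_n^P$ is the number of $F\in\mathcal{F}_{n,k}$ having $P$-matches starting at every position $1,\dots,n-1$, with $full_1^P=1$ by convention. $P\in St_{2^k}$ is degenerate if for each $1\le i<k$ at least one of $P(i,1)+1=P(i+1,1)$ or $P(i,2)+1=P(i+1,2)$ holds. -}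

module Defs where

open import Data.Fin using (Fin; toℕ; zero; suc)
import Data.Fin as Fin
open import Data.Fin.Patterns using (0F; 1F)
open import Data.Fin.Properties using (all?)
open import Data.List as List using (List)
open import Data.Nat using (ℕ; zero; suc; _+_; _*_; _<_; _<?_; _≤?_; _≟_)
open import Data.Product using (_×_)
open import Data.Sum using (_⊎_)
open import Data.Vec as Vec using (Vec; []; _∷_; lookup)
open import Data.Vec.Properties using (≡-dec)
open import Relation.Binary.PropositionalEquality using (_≡_)
open import Relation.Nullary using (Dec)
open import Relation.Nullary.Decidable using (_×-dec_; _→-dec_)

-- k rows of length n, the first component being the bottom row.
-- Rows and columns are indexed from 0, entries are genuine positive integers.
Array : ℕ → ℕ → Set
Array k n = Vec (Vec ℕ n) k

private
  variable
    k n : ℕ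

infixl 9 _[_,_]

_[_,_] : Array k n → Fin k → Fin n → ℕ
F [ i , j ] = lookup (lookup F i) j

-- Since there are k * n cells, no entry outside 1, …, k * n can occur.
EachOnce : Array k n → Set
EachOnce {k} {n} F =
  ∀ (v : Fin (k * n)) → Vec.count (suc (toℕ v) ≟_) (Vec.concat F) ≡ 1

ColumnsIncrease : Array k n → Set
ColumnsIncrease {k} {n} F =
  ∀ (i i′ : Fin k) (j : Fin n) → i Fin.< i′ → F [ i , j ] < F [ i′ , j ]

RowsIncrease : Array k n → Set
RowsIncrease {k} {n} F =
  ∀ (i : Fin k) (j j′ : Fin n) → j Fin.< j′ → F [ i , j ] < F [ i , j′ ]

IsFilling : Array k n → Set
IsFilling F = EachOnce F × ColumnsIncrease F

IsStandard : Array k 2 → Set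
IsStandard P = IsFilling P × RowsIncrease P

-- When the entries of F are distinct, x is the i-th smallest of them
-- exactly if i of them are at most x.
red : Array k n → Array k n
red F = Vec.map (Vec.map λ x → Vec.count (_≤? x) (Vec.concat F)) F

columns : Array k n → Fin n → Fin n → Array k 2
columns F j j′ = Vec.map (λ row → lookup row j ∷ lookup row j′ ∷ []) F

MatchesEverywhere : Array k 2 → Array k n → Set
MatchesEverywhere {n = n} P F =
  ∀ (j j′ : Fin n) → toℕ j′ ≡ suc (toℕ j) → red (columns F j j′) ≡ P

IsFull : Array k 2 → Array k n → Set
IsFull P F = IsFilling F × MatchesEverywhere P F

isFull? : (P : Array k 2) (F : Array k n) → Dec (IsFull P F)
isFull? P F =
  (all? (λ v → Vec.count (suc (toℕ v) ≟_) (Vec.concat F) ≟ 1)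
    ×-dec all? λ i → all? λ i′ → all? λ j →
      (i Fin.<? i′) →-dec (F [ i , j ] <? F [ i′ , j ]))
  ×-dec all? λ j → all? λ j′ →
    (toℕ j′ ≟ suc (toℕ j)) →-dec ≡-dec (≡-dec _≟_) (red (columns F j j′)) P

vectors : {A : Set} → List A → ∀ n → List (Vec A n)
vectors xs zero    = List.[ [] ]
vectors xs (suc n) = List.cartesianProductWith _∷_ xs (vectors xs n)

-- Every array with entries in 1, …, k * n, listed exactly once.
arrays : ∀ k n → List (Array k n)
arrays k n = vectors (vectors (List.map suc (List.upTo (k * n))) n) k

full : Array k 2 → ℕ → ℕ
full     P 1 = 1
full {k} P n = List.length (List.filter (isFull? P) (arrays k n))

Degenerate : Array k 2 → Set
Degenerate {k} P =
  ∀ (i i′ : Fin k) → toℕ i′ ≡ suc (toℕ i) →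
    P [ i , 0F ] + 1 ≡ P [ i′ , 0F ] ⊎ P [ i , 1F ] + 1 ≡ P [ i′ , 1F ]

{-# OPTIONS --safe #-}
module Submission where

-- A filling F has P-matches everywhere exactly if comparisons between
-- cells of the same column or of neighbouring columns come out as in P
-- (Realises below says this through order embeddings).  So the
-- question is whether these local comparisons determine the order of all
-- cells of F.
--
-- Existence.  A full filling with any number of columns is built from right
-- to left: each new leftmost column is inserted into the order of the old
-- cells, its entry in row r just before the first entry of the old leftmost
-- column that P requires to exceed it (Prepend, full-exists).
--
-- Degenerate patterns.  Suppose P is degenerate and F is full, let x lie in
-- column c + 1 and y in a column j < c.  Then some entry of column c lies
-- strictly between x and y (interpolate).  Otherwise, since rows increase,
-- x and y lie in one gap between two successive entries of column c.
-- By degeneracy this gap contains no entry of column c + 1, against the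
-- position of x, or no entry of column c - 1.  In the latter case, y being
-- in the gap means j < c - 1, and by induction on the distance c - j an
-- entry of column c - 1 lies between y and the lower end of the gap, hence
-- in the gap.  By the existence of these intermediate entries every
-- comparison follows, by transitivity, from comparisons in neighbouring
-- columns; so two full fillings are order isomorphic and thus equal
-- (full-unique).
--
-- Nondegenerate patterns.  If P is not degenerate at rows i and i + 1, then
-- in a full filling with three columns the gap between the entries of the
-- middle column in these rows contains entries of both outer columns and of
-- no other column.  Going up through the values, at some point v and v + 1
-- lie in different outer columns.  These cells are never compared by a match,
-- so exchanging v and v + 1 gives a second full filling
-- (nondegenerate⇒another), and the number of full fillings with three
-- columns is not 1.

open import Defs
open import Data.Fin as Fin using (Fin; toℕ; zero; suc; combine; punchOut; inject₁; fromℕ<)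
open import Data.Fin.Patterns using (0F; 1F; 2F)
open import Data.Fin.Properties as Fin
  using (any?; punchOut-injective; injective⇒≤; toℕ-injective; toℕ<n; toℕ-fromℕ<; toℕ-inject₁;
         combine-injective; combine-surjective)
open import Data.List as List using (List)
open import Data.List.Membership.Propositional using (_∈_)
open import Data.List.Membership.Propositional.Properties
  using (∈-filter⁺; ∈-filter⁻; ∈-map⁺; ∈-upTo⁺; ∈-cartesianProductWith⁺)
open import Data.List.Relation.Unary.All using ([]; _∷_)
open import Data.List.Relation.Unary.AllPairs using ([]; _∷_)
open import Data.List.Relation.Unary.Any using (here; there)
open import Data.List.Relation.Unary.Unique.Propositional using (Unique)
import Data.List.Relation.Unary.Unique.Propositional.Properties as Unique
open import Data.Nat
  using (ℕ; zero; suc; _+_; _*_; _∸_; _<_; _≤_; _≥_; z≤n; s≤s; s≤s⁻¹; _<?_; _≤?_; _≟_)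
open import Data.Nat.Properties
open import Data.Product using (∃; ∃₂; _×_; _,_; proj₁; proj₂)
open import Data.Sum using (_⊎_; inj₁; inj₂)
open import Data.Vec as Vec using (Vec; []; _∷_; lookup; count)
open import Data.Vec.Properties
  using (count≤n; lookup-map; lookup-concat; lookup∘tabulate; tabulate∘lookup; tabulate-cong; ∷-injective)
open import Function using (_∘_; Injective)
open import Function.Bundles using (_⇔_; mk⇔)
open import Level using (Level)
open import Relation.Binary.Definitions using (Tri; tri<; tri≈; tri>)
open import Relation.Binary.PropositionalEquality hiding ([_])
open import Relation.Nullary using (¬_; Dec; yes; no; contradiction)
open import Relation.Nullary.Decidable using (_×-dec_; _⊎-dec_)
open import Relation.Unary using (Pred; Decidable)

private
  variable
    p q r : Level
    A : Set
    k n : ℕ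

-- Finite sets and vectors

-- j′ comes right after j; used for rows, columns and values alike.
Consecutive : Fin n → Fin n → Set
Consecutive j j′ = toℕ j′ ≡ suc (toℕ j)

injective⇒hits : {f : Fin n → Fin n} → Injective _≡_ _≡_ f → ∀ v → ∃ λ u → f u ≡ v
injective⇒hits {suc n} {f} f-inj v with any? (λ u → f u Fin.≟ v)
... | yes hit  = hit
... | no  miss = contradiction (injective⇒≤ avoid-inj) 1+n≰n
  where
  v≢f : ∀ u → v ≢ f u
  v≢f u eq = miss (u , sym eq)

  avoid-inj : Injective _≡_ _≡_ (λ u → punchOut (v≢f u))
  avoid-inj {x} {y} = f-inj ∘ punchOut-injective (v≢f x) (v≢f y)

-- A decidable property that holds at s and fails at a later r is lost
-- at some single step between them.
step-between : {Q : Pred (Fin n) q} → Decidable Q → ∀ {s r} → s Fin.≤ r → Q s → ¬ Q r →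
  ∃₂ λ i i′ → Consecutive i i′ × s Fin.≤ i × i′ Fin.≤ r × Q i × ¬ Q i′
step-between {suc n} Q? {zero} {zero} _ Qs ¬Qr = contradiction Qs ¬Qr
step-between {suc (suc n)} Q? {zero} {suc r} _ Qs ¬Qr with Q? (suc zero)
... | no ¬Q1 = zero , suc zero , refl , z≤n , s≤s z≤n , Qs , ¬Q1
... | yes Q1 with i , i′ , eq , _ , i′≤r , Qi , ¬Qi′ ← step-between (Q? ∘ suc) {zero} {r} z≤n Q1 ¬Qr =
  suc i , suc i′ , cong suc eq , z≤n , s≤s i′≤r , Qi , ¬Qi′
step-between {suc n} Q? {suc s} {suc r} (s≤s s≤r) Qs ¬Qr
  with i , i′ , eq , s≤i , i′≤r , Qi , ¬Qi′ ← step-between (Q? ∘ suc) s≤r Qs ¬Qr =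
  suc i , suc i′ , cong suc eq , s≤s s≤i , s≤s i′≤r , Qi , ¬Qi′

least : {Q : Pred (Fin n) q} → Decidable Q → ∀ r → Q r →
  ∃ λ s → Q s × (∀ t → Q t → s Fin.≤ t)
least {n = suc n} Q? r Qr with Q? zero
... | yes Q0 = zero , Q0 , λ _ _ → z≤n
least {n = suc n} Q? zero    Qr | no ¬Q0 = contradiction Qr ¬Q0
least {n = suc n} Q? (suc r) Qr | no ¬Q0 with s , Qs , s-least ← least (Q? ∘ suc) r Qr =
  suc s , Qs , λ { zero Q0 → contradiction Q0 ¬Q0 ; (suc t) Qt → s≤s (s-least t Qt) }

lookup-ext : {xs ys : Vec A n} → (∀ i → lookup xs i ≡ lookup ys i) → xs ≡ ys
lookup-ext {xs = xs} {ys} eq =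
  trans (sym (tabulate∘lookup xs)) (trans (tabulate-cong eq) (tabulate∘lookup ys))

array-ext : {F G : Array k n} → (∀ i j → F [ i , j ] ≡ G [ i , j ]) → F ≡ G
array-ext eq = lookup-ext λ i → lookup-ext (eq i)

-- Counting

module _ {P : Pred ℕ p} {Q : Pred ℕ q} (P? : Decidable P) (Q? : Decidable Q) where

  count-mono : (xs ys : Vec ℕ n) → (∀ i → P (lookup xs i) → Q (lookup ys i)) →
    count P? xs ≤ count Q? ys
  count-mono []       []       P⇒Q = z≤n
  count-mono (x ∷ xs) (y ∷ ys) P⇒Q with P? x | Q? y | count-mono xs ys (P⇒Q ∘ suc)
  ... | yes Px | no ¬Qy | _  = contradiction (P⇒Q zero Px) ¬Qy
  ... | yes _  | yes _  | le = s≤s le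
  ... | no  _  | yes _  | le = m≤n⇒m≤1+n le
  ... | no  _  | no  _  | le = le

  count-mono-< : (xs : Vec ℕ n) → (∀ i → P (lookup xs i) → Q (lookup xs i)) →
    ∀ i → ¬ P (lookup xs i) → Q (lookup xs i) → count P? xs < count Q? xs
  count-mono-< (x ∷ xs) P⇒Q zero ¬Px Qx with P? x | Q? x
  ... | yes Px | _      = contradiction Px ¬Px
  ... | no  _  | no ¬Qx = contradiction Qx ¬Qx
  ... | no  _  | yes _  = s≤s (count-mono xs xs (P⇒Q ∘ suc))
  count-mono-< (x ∷ xs) P⇒Q (suc i) ¬Pi Qi with P? x | Q? x | count-mono-< xs (P⇒Q ∘ suc) i ¬Pi Qi
  ... | yes Px | no ¬Qx | _  = contradiction (P⇒Q zero Px) ¬Qx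
  ... | yes _  | yes _  | lt = s≤s lt
  ... | no  _  | yes _  | lt = m≤n⇒m≤1+n lt
  ... | no  _  | no  _  | lt = lt

module _ {P : Pred ℕ p} (P? : Decidable P) where

  count-none : (xs : Vec ℕ n) → (∀ i → ¬ P (lookup xs i)) → count P? xs ≡ 0
  count-none []       none = refl
  count-none (x ∷ xs) none with P? x
  ... | yes Px = contradiction Px (none zero)
  ... | no  _  = count-none xs (none ∘ suc)

  count-some : (xs : Vec ℕ n) → count P? xs ≢ 0 → ∃ λ i → P (lookup xs i)
  count-some xs count≢0 with any? (λ i → P? (lookup xs i))
  ... | yes some = some
  ... | no  none = contradiction (count-none xs λ i Pi → none (i , Pi)) count≢0

  count-positive : (xs : Vec ℕ n) → ∀ i → P (lookup xs i) → 0 < count P? xs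
  count-positive (x ∷ xs) i Pi with P? x
  ... | yes _ = s≤s z≤n
  count-positive (x ∷ xs) zero    Px | no ¬Px = contradiction Px ¬Px
  count-positive (x ∷ xs) (suc i) Pi | no _   = count-positive xs i Pi

  count-single : (xs : Vec ℕ n) → ∀ i → P (lookup xs i) → (∀ j → P (lookup xs j) → j ≡ i) →
    count P? xs ≡ 1
  count-single (x ∷ xs) zero Px only with P? x
  ... | no ¬Px = contradiction Px ¬Px
  ... | yes _  = cong suc (count-none xs λ j Pj → contradiction (only (suc j) Pj) λ ())
  count-single (x ∷ xs) (suc i) Pi only with P? x
  ... | yes Px = contradiction (only zero Px) λ ()
  ... | no _   = count-single xs i Pi λ j Pj → Fin.suc-injective (only (suc j) Pj)

count-⊎ : {P : Pred ℕ p} {Q : Pred ℕ q} {R : Pred ℕ r}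
  (P? : Decidable P) (Q? : Decidable Q) (R? : Decidable R) →
  (∀ {x} → R x → P x ⊎ Q x) → (∀ {x} → P x → R x) → (∀ {x} → Q x → R x) →
  (∀ {x} → P x → ¬ Q x) →
  (xs : Vec ℕ n) → count R? xs ≡ count P? xs + count Q? xs
count-⊎ P? Q? R? split P⇒R Q⇒R P⇒¬Q []       = refl
count-⊎ P? Q? R? split P⇒R Q⇒R P⇒¬Q (x ∷ xs)
  with P? x | Q? x | R? x | count-⊎ P? Q? R? split P⇒R Q⇒R P⇒¬Q xs
... | yes Px | yes Qx | _      | _  = contradiction Qx (P⇒¬Q Px)
... | yes Px | no _   | no ¬Rx | _  = contradiction (P⇒R Px) ¬Rx
... | yes _  | no _   | yes _  | eq = cong suc eq
... | no _   | yes Qx | no ¬Rx | _  = contradiction (Q⇒R Qx) ¬Rx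
... | no _   | yes _  | yes _  | eq = trans (cong suc eq) (sym (+-suc _ _))
... | no _   | no _   | no _   | eq = eq
... | no ¬Px | no ¬Qx | yes Rx | _ with split Rx
...   | inj₁ Px = contradiction Px ¬Px
...   | inj₂ Qx = contradiction Qx ¬Qx

count-≤-suc : ∀ x (xs : Vec ℕ n) →
  count (_≤? suc x) xs ≡ count (suc x ≟_) xs + count (_≤? x) xs
count-≤-suc x = count-⊎ (suc x ≟_) (_≤? x) (_≤? suc x)
  split (λ { refl → ≤-refl }) m≤n⇒m≤1+n (λ { refl → 1+n≰n })
  where
  split : ∀ {y} → y ≤ suc x → suc x ≡ y ⊎ y ≤ x
  split le with m≤n⇒m<n∨m≡n le
  ... | inj₁ (s≤s y≤x) = inj₂ y≤x
  ... | inj₂ y≡1+x     = inj₁ (sym y≡1+x)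

-- Vectors containing each of 1, …, n once

-- EachOnce F is Once of the concatenated rows of F.
Once : Vec ℕ n → Set
Once {n} xs = ∀ (v : Fin n) → count (suc (toℕ v) ≟_) xs ≡ 1

module _ (xs : Vec ℕ n) (once : Once xs) where

  private
    entry-at : ∀ v → ∃ λ i → suc (toℕ v) ≡ lookup xs i
    entry-at v = count-some (suc (toℕ v) ≟_) xs λ eq → 1+n≢0 (trans (sym (once v)) eq)

  -- Where the entry suc v stands.  This map is injective, hence a permutation
  -- of the indices, which yields the two properties of the entries below.
  position : Fin n → Fin n
  position v = proj₁ (entry-at v)

  lookup-position : ∀ v → lookup xs (position v) ≡ suc (toℕ v)
  lookup-position v = sym (proj₂ (entry-at v))

  position-injective : Injective _≡_ _≡_ position
  position-injective {u} {v} eq = toℕ-injective (suc-injective (begin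
    suc (toℕ u)            ≡⟨ lookup-position u ⟨
    lookup xs (position u) ≡⟨ cong (lookup xs) eq ⟩
    lookup xs (position v) ≡⟨ lookup-position v ⟩
    suc (toℕ v)            ∎))
    where open ≡-Reasoning

  once⇒entry : ∀ i → ∃ λ v → lookup xs i ≡ suc (toℕ v)
  once⇒entry i with v , refl ← injective⇒hits position-injective i = v , lookup-position v

  once⇒injective : Injective _≡_ _≡_ (lookup xs)
  once⇒injective {i} {j} eq
    with u , refl ← injective⇒hits position-injective i
       | v , refl ← injective⇒hits position-injective j =
    cong position (toℕ-injective (suc-injective
      (trans (sym (lookup-position u)) (trans eq (lookup-position v)))))

  once⇒count-≤ : ∀ x → x ≤ n → count (_≤? x) xs ≡ x
  once⇒count-≤ zero    _   = count-none (_≤? 0) xs λ i →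
    subst (¬_ ∘ (_≤ 0)) (sym (proj₂ (once⇒entry i))) λ ()
  once⇒count-≤ (suc x) x<n = begin
    count (_≤? suc x) xs                       ≡⟨ count-≤-suc x xs ⟩
    count (suc x ≟_) xs + count (_≤? x) xs     ≡⟨ cong₂ _+_ once-suc-x (once⇒count-≤ x (<⇒≤ x<n)) ⟩
    suc x                                      ∎
    where
    open ≡-Reasoning
    once-suc-x : count (suc x ≟_) xs ≡ 1
    once-suc-x = subst (λ y → count (suc y ≟_) xs ≡ 1) (toℕ-fromℕ< x<n) (once (fromℕ< x<n))

injective⇒once : (xs : Vec ℕ n) → Injective _≡_ _≡_ (lookup xs) →
  (∀ i → ∃ λ (v : Fin n) → lookup xs i ≡ suc (toℕ v)) → Once xs
injective⇒once xs inj entry v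
  with i , refl ← injective⇒hits
         (λ {i} {j} eq → inj (trans (proj₂ (entry i))
           (trans (cong (suc ∘ toℕ) eq) (sym (proj₂ (entry j)))))) v =
  count-single _ xs i (sym (proj₂ (entry i)))
    λ j eq → inj (trans (sym eq) (sym (proj₂ (entry i))))

-- Arrays up to order isomorphism

-- The entries are pairwise different, though not necessarily 1, …, k * n.
Distinct : Array k n → Set
Distinct F = ∀ {i j i′ j′} → F [ i , j ] ≡ F [ i′ , j′ ] → i ≡ i′ × j ≡ j′

infix 4 _⊑_

-- Every strict comparison between two cells that holds in F holds in G.
-- If F is Distinct, F and G are then order isomorphic.
_⊑_ : Array k n → Array k n → Set
F ⊑ G = ∀ i j i′ j′ → F [ i , j ] < F [ i′ , j′ ] → G [ i , j ] < G [ i′ , j′ ]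

⊑-trans : {F G H : Array k n} → F ⊑ G → G ⊑ H → F ⊑ H
⊑-trans F⊑G G⊑H i j i′ j′ = G⊑H i j i′ j′ ∘ F⊑G i j i′ j′

-- The number of entries of F that are at most x.
rank : Array k n → ℕ → ℕ
rank F x = count (_≤? x) (Vec.concat F)

red-lookup : ∀ (F : Array k n) i j → red F [ i , j ] ≡ rank F (F [ i , j ])
red-lookup F i j = trans (cong (λ row → lookup row j) (lookup-map i (Vec.map (rank F)) F))
                         (lookup-map j (rank F) (lookup F i))

rank-mono-< : ∀ (F : Array k n) {x} i j → x < F [ i , j ] → rank F x < rank F (F [ i , j ])
rank-mono-< F {x} i j x<y =
  count-mono-< (_≤? x) (_≤? F [ i , j ]) (Vec.concat F) (λ _ z≤x → ≤-trans z≤x (<⇒≤ x<y))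
    (combine i j)
    (λ le → <⇒≱ x<y (subst (_≤ x) (lookup-concat F i j) le))
    (≤-reflexive (lookup-concat F i j))

⊑-red : (F : Array k n) → F ⊑ red F
⊑-red F i j i′ j′ lt = subst₂ _<_ (sym (red-lookup F i j)) (sym (red-lookup F i′ j′))
  (rank-mono-< F i′ j′ lt)

red-⊑ : (F : Array k n) → red F ⊑ F
red-⊑ F i j i′ j′ lt = ≰⇒> λ le → <⇒≱ (subst₂ _<_ (red-lookup F i j) (red-lookup F i′ j′) lt)
  (count-mono (_≤? _) (_≤? _) (Vec.concat F) (Vec.concat F) λ _ z≤ → ≤-trans z≤ le)

⊑-reflects-≤ : ∀ {F G : Array k n} → F ⊑ G → ∀ i j i′ j′ →
  G [ i , j ] ≤ G [ i′ , j′ ] → F [ i , j ] ≤ F [ i′ , j′ ]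
⊑-reflects-≤ F⊑G i j i′ j′ le = ≮⇒≥ λ lt → <⇒≱ (F⊑G i′ j′ i j lt) le

⊑-preserves-≤ : ∀ {F G : Array k n} → Distinct F → F ⊑ G → ∀ i j i′ j′ →
  F [ i , j ] ≤ F [ i′ , j′ ] → G [ i , j ] ≤ G [ i′ , j′ ]
⊑-preserves-≤ dist F⊑G i j i′ j′ le with m≤n⇒m<n∨m≡n le
... | inj₁ lt = <⇒≤ (F⊑G i j i′ j′ lt)
... | inj₂ eq with refl , refl ← dist {i} {j} {i′} {j′} eq = ≤-refl

-- Reduction only depends on the order type.  Distinctness makes F ⊑ G reflect
-- as well as preserve order.
red-cong : {F G : Array k n} → Distinct F → F ⊑ G → red F ≡ red G
red-cong {k} {n} {F} {G} dist F⊑G = array-ext λ i j →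
  trans (red-lookup F i j) (trans (≤-antisym
    (count-mono (_≤? _) (_≤? _) (Vec.concat F) (Vec.concat G) (to i j))
    (count-mono (_≤? _) (_≤? _) (Vec.concat G) (Vec.concat F) (from i j)))
    (sym (red-lookup G i j)))
  where
  to : ∀ i j a → lookup (Vec.concat F) a ≤ F [ i , j ] → lookup (Vec.concat G) a ≤ G [ i , j ]
  to i j a le with i′ , j′ , refl ← combine-surjective {k} {n} a =
    subst (_≤ _) (sym (lookup-concat G i′ j′))
      (⊑-preserves-≤ {F = F} {G} dist F⊑G i′ j′ i j (subst (_≤ _) (lookup-concat F i′ j′) le))

  from : ∀ i j a → lookup (Vec.concat G) a ≤ G [ i , j ] → lookup (Vec.concat F) a ≤ F [ i , j ]
  from i j a le with i′ , j′ , refl ← combine-surjective {k} {n} a =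
    subst (_≤ _) (sym (lookup-concat F i′ j′))
      (⊑-reflects-≤ {F = F} {G} F⊑G i′ j′ i j (subst (_≤ _) (lookup-concat G i′ j′) le))

module _ (F : Array k n) (each : EachOnce F) where

  eachOnce⇒distinct : Distinct F
  eachOnce⇒distinct {i} {j} {i′} {j′} eq = combine-injective i j i′ j′
    (once⇒injective (Vec.concat F) each (trans (lookup-concat F i j) (trans eq (sym (lookup-concat F i′ j′)))))

  eachOnce⇒entry : ∀ i j → ∃ λ (v : Fin (k * n)) → F [ i , j ] ≡ suc (toℕ v)
  eachOnce⇒entry i j with v , eq ← once⇒entry (Vec.concat F) each (combine i j) =
    v , trans (sym (lookup-concat F i j)) eq

  eachOnce⇒cell : ∀ (v : Fin (k * n)) → ∃₂ λ i j → F [ i , j ] ≡ suc (toℕ v)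
  eachOnce⇒cell v with i , j , eq ← combine-surjective {k} {n} (position (Vec.concat F) each v) =
    i , j , trans (sym (lookup-concat F i j))
      (trans (cong (lookup (Vec.concat F)) eq) (lookup-position (Vec.concat F) each v))

  eachOnce⇒red : red F ≡ F
  eachOnce⇒red = array-ext λ i j → trans (red-lookup F i j) (once⇒count-≤ (Vec.concat F) each (F [ i , j ])
    (subst (_≤ k * n) (sym (proj₂ (eachOnce⇒entry i j))) (toℕ<n (proj₁ (eachOnce⇒entry i j)))))

distinct⇒red-eachOnce : {F : Array k n} → Distinct F → EachOnce (red F)
distinct⇒red-eachOnce {k} {n} {F} dist = injective⇒once (Vec.concat (red F))
  (λ {a} {b} → inj a b) entry
  where
  red-dist : Distinct (red F)
  red-dist {i} {j} {i′} {j′} eq = dist (≤-antisym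
    (⊑-reflects-≤ {F = F} {red F} (⊑-red F) i j i′ j′ (≤-reflexive eq))
    (⊑-reflects-≤ {F = F} {red F} (⊑-red F) i′ j′ i j (≤-reflexive (sym eq))))

  inj : ∀ a b → lookup (Vec.concat (red F)) a ≡ lookup (Vec.concat (red F)) b → a ≡ b
  inj a b eq
    with i , j , refl ← combine-surjective {k} {n} a
       | i′ , j′ , refl ← combine-surjective {k} {n} b
    with refl , refl ← red-dist {i} {j} {i′} {j′}
           (trans (sym (lookup-concat (red F) i j)) (trans eq (lookup-concat (red F) i′ j′))) = refl

  entry : ∀ a → ∃ λ (v : Fin (k * n)) → lookup (Vec.concat (red F)) a ≡ suc (toℕ v)
  entry a with i , j , refl ← combine-surjective {k} {n} a
    = bounded (trans (lookup-concat (red F) i j) (red-lookup F i j))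
        (count-positive (_≤? _) (Vec.concat F) (combine i j) (≤-reflexive (lookup-concat F i j)))
        (count≤n (_≤? _) (Vec.concat F))
    where
    bounded : ∀ {x y} → x ≡ y → 0 < y → y ≤ k * n → ∃ λ (v : Fin (k * n)) → x ≡ suc (toℕ v)
    bounded {y = suc y} eq _ y<kn = fromℕ< y<kn , trans eq (cong suc (sym (toℕ-fromℕ< y<kn)))

-- Matches as order embeddings

-- The column of the whole array that column c of columns F j j′ comes from.
pick : Fin n → Fin n → Fin 2 → Fin n
pick j j′ 0F = j
pick j j′ 1F = j′

columns-lookup : ∀ (F : Array k n) j j′ r c → columns F j j′ [ r , c ] ≡ F [ r , pick j j′ c ]
columns-lookup F j j′ r 0F = cong (λ v → lookup v 0F) (lookup-map r _ F)
columns-lookup F j j′ r 1F = cong (λ v → lookup v 1F) (lookup-map r _ F)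

columns-⊑ : (F G : Array k n) → F ⊑ G → ∀ j j′ → columns F j j′ ⊑ columns G j j′
columns-⊑ F G F⊑G j j′ r c r′ c′ lt =
  subst₂ _<_ (sym (columns-lookup G j j′ r c)) (sym (columns-lookup G j j′ r′ c′))
    (F⊑G r (pick j j′ c) r′ (pick j j′ c′)
      (subst₂ _<_ (columns-lookup F j j′ r c) (columns-lookup F j j′ r′ c′) lt))

column-reflects-< : ∀ {F : Array k n} → ColumnsIncrease F → ∀ {r s j} →
  F [ r , j ] < F [ s , j ] → r Fin.< s
column-reflects-< inc {r} {s} {j} lt with Fin.<-cmp r s
... | tri< r<s _ _  = r<s
... | tri≈ _ refl _ = contradiction lt (<-irrefl refl)
... | tri> _ _ s<r  = contradiction (inc s r j s<r) (<-asym lt)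

increase⇒mono : ∀ {F : Array k n} → ColumnsIncrease F → ∀ {r s j} →
  r Fin.≤ s → F [ r , j ] ≤ F [ s , j ]
increase⇒mono {F = F} inc {r} {s} {j} r≤s with m≤n⇒m<n∨m≡n r≤s
... | inj₁ r<s = <⇒≤ (inc r s j r<s)
... | inj₂ r≡s = ≤-reflexive (cong (λ t → F [ t , j ]) (toℕ-injective r≡s))

-- A full filling up to reduction: F is arranged like a full filling, but its
-- entries may be any distinct natural numbers, including 0.
record Realises (P : Array k 2) (F : Array k n) : Set where
  field
    distinct  : Distinct F
    increase  : ColumnsIncrease F
    embeds    : ∀ j j′ → Consecutive j j′ → P ⊑ columns F j j′

realises⇒full : {P : Array k 2} {F : Array k n} → IsFilling P → Realises P F → IsFull P (red F)
realises⇒full {P = P} {F} (once-P , _) real =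
    ( distinct⇒red-eachOnce {F = F} distinct
    , λ i i′ j i<i′ → ⊑-red F i j i′ j (increase i i′ j i<i′) )
  , λ j j′ cons → begin
      red (columns (red F) j j′) ≡⟨ red-cong (λ {i} {j} → eachOnce⇒distinct P once-P {i} {j})
                                      (P⊑ j j′ cons) ⟨
      red P                      ≡⟨ eachOnce⇒red P once-P ⟩
      P                          ∎
  where
  open Realises real
  open ≡-Reasoning

  P⊑ : ∀ j j′ → Consecutive j j′ → P ⊑ columns (red F) j j′
  P⊑ j j′ cons = ⊑-trans {F = P} {columns F j j′} {columns (red F) j j′}
    (embeds j j′ cons) (columns-⊑ F (red F) (⊑-red F) j j′)

embeds-columns : {P : Array k 2} {F : Array k n} → ColumnsIncrease P → ColumnsIncrease F → ∀ {j j′} →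
  (∀ r s → P [ r , 0F ] < P [ s , 1F ] → F [ r , j ] < F [ s , j′ ]) →
  (∀ r s → P [ s , 1F ] < P [ r , 0F ] → F [ s , j′ ] < F [ r , j ]) →
  P ⊑ columns F j j′
embeds-columns {P = P} {F} inc-P inc-F {j} {j′} lr rl r c r′ c′ lt =
  subst₂ _<_ (sym (columns-lookup F j j′ r c)) (sym (columns-lookup F j j′ r′ c′)) (go c c′ lt)
  where
  go : ∀ c c′ → P [ r , c ] < P [ r′ , c′ ] → F [ r , pick j j′ c ] < F [ r′ , pick j j′ c′ ]
  go 0F 0F lt = inc-F r r′ j (column-reflects-< {F = P} inc-P lt)
  go 1F 1F lt = inc-F r r′ j′ (column-reflects-< {F = P} inc-P lt)
  go 0F 1F lt = lr r r′ lt
  go 1F 0F lt = rl r′ r lt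

-- Existence of full fillings

-- A new leftmost column is put in front of F without touching the order of the
-- old entries: these are stretched by the factor k + 1, which makes room for k
-- new entries below each of them.
module Prepend {P : Array k 2} (standard : IsStandard P) where

  private
    rows-P : ∀ r → P [ r , 0F ] < P [ r , 1F ]
    rows-P r = proj₂ standard r 0F 1F (s≤s z≤n)

    inc-P : ColumnsIncrease P
    inc-P = proj₂ (proj₁ standard)

    -- Row r itself qualifies, as the rows of P increase.
    above-least : ∀ r → ∃ λ s → P [ r , 0F ] < P [ s , 1F ] ×
      (∀ t → P [ r , 0F ] < P [ t , 1F ] → s Fin.≤ t)
    above-least r = least (λ s → P [ r , 0F ] <? P [ s , 1F ]) r (rows-P r)

  -- The row of the lowest entry in the right column of P exceeding P [ r , 0F ].
  above : Fin k → Fin k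
  above r = proj₁ (above-least r)

  -- For t at most k, the pairs (x , t) in lexicographic order.
  stretch : ℕ → ℕ → ℕ
  stretch x t = suc k * x + t

  stretch-< : ∀ {x y t u} → x < y → t ≤ k → stretch x t < stretch y u
  stretch-< {x} {y} {t} {u} x<y t≤k = begin-strict
    suc k * x + t     <⟨ +-monoʳ-< (suc k * x) (s≤s t≤k) ⟩
    suc k * x + suc k ≡⟨ +-comm (suc k * x) (suc k) ⟩
    suc k + suc k * x ≡⟨ *-suc (suc k) x ⟨
    suc k * suc x     ≤⟨ *-monoʳ-≤ (suc k) x<y ⟩
    suc k * y         ≤⟨ m≤m+n (suc k * y) u ⟩
    suc k * y + u     ∎
    where open ≤-Reasoning

  stretch-≤-< : ∀ {x y t u} → x ≤ y → t < u → u ≤ k → stretch x t < stretch y u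
  stretch-≤-< x≤y t<u u≤k = +-mono-≤-< (*-monoʳ-≤ (suc k) x≤y) t<u

  stretch-injective : ∀ {x y t u} → t ≤ k → u ≤ k → stretch x t ≡ stretch y u → x ≡ y × t ≡ u
  stretch-injective {x} {y} {t} {u} t≤k u≤k eq with <-cmp x y
  ... | tri< x<y _ _  = contradiction eq (<⇒≢ (stretch-< {t = t} {u} x<y t≤k))
  ... | tri≈ _ refl _ = refl , +-cancelˡ-≡ (suc k * x) t u eq
  ... | tri> _ _ y<x  = contradiction (sym eq) (<⇒≢ (stretch-< {t = u} {t} y<x u≤k))

  -- Old entries carry the offset k, which exceeds the offset toℕ r of the new
  -- entry in row r.  So this entry lands just below the old entry in row above r
  -- of the leftmost column.
  prepend : Array k (suc n) → Array k (suc (suc n))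
  prepend F = Vec.tabulate λ r →
    stretch (F [ above r , 0F ]) (toℕ r) ∷ Vec.map (λ x → stretch x k) (lookup F r)

  module _ (F : Array k (suc n)) where

    prepend-new : ∀ r → prepend F [ r , 0F ] ≡ stretch (F [ above r , 0F ]) (toℕ r)
    prepend-new r = cong (λ row → lookup row 0F) (lookup∘tabulate _ r)

    prepend-old : ∀ r j → prepend F [ r , suc j ] ≡ stretch (F [ r , j ]) k
    prepend-old r j = trans (cong (λ row → lookup row (suc j)) (lookup∘tabulate _ r))
                            (lookup-map j _ (lookup F r))

    private
      toℕ≤k : ∀ (r : Fin k) → toℕ r ≤ k
      toℕ≤k r = <⇒≤ (toℕ<n r)

    above-mono : ColumnsIncrease F → ∀ {r s} → r Fin.< s → F [ above r , 0F ] ≤ F [ above s , 0F ]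
    above-mono inc {r} {s} r<s = increase⇒mono {F = F} inc
      (proj₂ (proj₂ (above-least r)) (above s)
        (<-trans (inc-P r s 0F r<s) (proj₁ (proj₂ (above-least s)))))

    prepend-increase : ColumnsIncrease F → ColumnsIncrease (prepend F)
    prepend-increase inc r s 0F r<s = subst₂ _<_ (sym (prepend-new r)) (sym (prepend-new s))
      (stretch-≤-< (above-mono inc r<s) r<s (toℕ≤k s))
    prepend-increase inc r s (suc j) r<s = subst₂ _<_ (sym (prepend-old r j)) (sym (prepend-old s j))
      (stretch-< {t = k} {k} (inc r s j r<s) ≤-refl)

    prepend-distinct : Distinct F → Distinct (prepend F)
    prepend-distinct dist {r} {0F} {s} {0F} eq =
      toℕ-injective (proj₂ (stretch-injective (toℕ≤k r) (toℕ≤k s)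
        (trans (sym (prepend-new r)) (trans eq (prepend-new s))))) , refl
    prepend-distinct dist {r} {0F} {s} {suc l} eq =
      contradiction (proj₂ (stretch-injective {t = toℕ r} (toℕ≤k r) ≤-refl
        (trans (sym (prepend-new r)) (trans eq (prepend-old s l))))) (<⇒≢ (toℕ<n r))
    prepend-distinct dist {r} {suc j} {s} {0F} eq =
      contradiction (sym (proj₂ (stretch-injective {u = toℕ s} ≤-refl (toℕ≤k s)
        (trans (sym (prepend-old r j)) (trans eq (prepend-new s)))))) (<⇒≢ (toℕ<n s))
    prepend-distinct dist {r} {suc j} {s} {suc l} eq
      with refl , refl ← dist {r} {j} {s} {l} (proj₁ (stretch-injective {t = k} ≤-refl ≤-refl
             (trans (sym (prepend-old r j)) (trans eq (prepend-old s l))))) = refl , refl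

    prepend-realises : Realises P F → Realises P (prepend F)
    prepend-realises real = record
      { distinct = λ {i} {j} → prepend-distinct distinct {i} {j}
      ; increase = prepend-increase increase
      ; embeds   = go
      }
      where
      open Realises real

      new<old : ∀ r s → P [ r , 0F ] < P [ s , 1F ] → prepend F [ r , 0F ] < prepend F [ s , 1F ]
      new<old r s lt = subst₂ _<_ (sym (prepend-new r)) (sym (prepend-old s 0F))
        (stretch-≤-< {t = toℕ r} (increase⇒mono {F = F} increase (proj₂ (proj₂ (above-least r)) s lt))
          (toℕ<n r) ≤-refl)

      old<new : ∀ r s → P [ s , 1F ] < P [ r , 0F ] → prepend F [ s , 1F ] < prepend F [ r , 0F ]
      old<new r s lt = subst₂ _<_ (sym (prepend-old s 0F)) (sym (prepend-new r))
        (stretch-< {t = k} {toℕ r} (increase s (above r) 0F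
          (column-reflects-< {F = P} inc-P (<-trans lt (proj₁ (proj₂ (above-least r)))))) ≤-refl)

      go : ∀ j j′ → Consecutive j j′ → P ⊑ columns (prepend F) j j′
      go 0F      (suc 0F)  refl =
        embeds-columns {P = P} {prepend F} inc-P (prepend-increase increase) new<old old<new
      go (suc j) (suc j′)  cons r c r′ c′ lt = subst₂ _<_ (sym (old r c)) (sym (old r′ c′))
          (stretch-< {t = k} {k} (embeds j j′ (suc-injective cons) r c r′ c′ lt) ≤-refl)
        where
        old : ∀ r c → columns (prepend F) (suc j) (suc j′) [ r , c ] ≡ stretch (columns F j j′ [ r , c ]) k
        old r c = trans (columns-lookup (prepend F) (suc j) (suc j′) r c)
          (trans (old′ r c) (cong (λ x → stretch x k) (sym (columns-lookup F j j′ r c))))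
          where
          old′ : ∀ r c → prepend F [ r , pick (suc j) (suc j′) c ] ≡ stretch (F [ r , pick j j′ c ]) k
          old′ r 0F = prepend-old r j
          old′ r 1F = prepend-old r j′

  realisation : ∀ n → ∃ λ (F : Array k (suc n)) → Realises P F
  realisation zero = single , record
    { distinct = λ { {i} {0F} {i′} {0F} eq →
        toℕ-injective (trans (sym (single-lookup i)) (trans eq (single-lookup i′))) , refl }
    ; increase = λ { i i′ 0F i<i′ → subst₂ _<_ (sym (single-lookup i)) (sym (single-lookup i′)) i<i′ }
    ; embeds   = λ { 0F 0F () }
    }
    where
    -- The entries of the single column are 0, …, k - 1.
    single : Array k 1
    single = Vec.tabulate λ r → toℕ r ∷ []

    single-lookup : ∀ r → single [ r , 0F ] ≡ toℕ r
    single-lookup r = cong (λ row → lookup row 0F) (lookup∘tabulate _ r)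
  realisation (suc n) with F , real ← realisation n = prepend F , prepend-realises F real

-- Interpolation in full fillings

-- Comparisons within two neighbouring columns of F are read off from P and
-- conversely (from-pattern, to-pattern).
module Full {P : Array k 2} (standard : IsStandard P) {F : Array k n} (full-F : IsFull P F) where

  once-F : EachOnce F
  once-F = proj₁ (proj₁ full-F)

  inc-F : ColumnsIncrease F
  inc-F = proj₂ (proj₁ full-F)

  embeds-F : ∀ j j′ → Consecutive j j′ → P ⊑ columns F j j′
  embeds-F j j′ cons = subst (_⊑ columns F j j′) (proj₂ full-F j j′ cons) (red-⊑ (columns F j j′))

  distinct-F : Distinct F
  distinct-F {i} {j} = eachOnce⇒distinct F once-F {i} {j}

  module _ {j j′ : Fin n} (cons : Consecutive j j′) where

    from-pattern : ∀ {r s} c c′ → P [ r , c ] < P [ s , c′ ] →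
      F [ r , pick j j′ c ] < F [ s , pick j j′ c′ ]
    from-pattern {r} {s} c c′ lt =
      subst₂ _<_ (columns-lookup F j j′ r c) (columns-lookup F j j′ s c′) (embeds-F j j′ cons r c s c′ lt)

    to-pattern : ∀ {r s} c c′ → F [ r , pick j j′ c ] < F [ s , pick j j′ c′ ] →
      P [ r , c ] < P [ s , c′ ]
    to-pattern {r} {s} c c′ lt =
      subst (columns F j j′ ⊑_) (proj₂ full-F j j′ cons) (⊑-red (columns F j j′)) r c s c′
        (subst₂ _<_ (sym (columns-lookup F j j′ r c)) (sym (columns-lookup F j j′ s c′)) lt)

    row-step : ∀ r → F [ r , j ] < F [ r , j′ ]
    row-step r = from-pattern 0F 1F (proj₂ standard r 0F 1F (s≤s z≤n))

  predecessor : ∀ {m} (c : Fin n) → toℕ c ≡ suc m → ∃ λ (b : Fin n) → toℕ b ≡ m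
  predecessor (suc b) refl = inject₁ b , toℕ-inject₁ b

  -- Here and below the distance between two columns is expressed as
  -- toℕ c ≡ suc (d + toℕ j), and the induction is on d.
  rows-< : ∀ d {j c} → toℕ c ≡ suc (d + toℕ j) → ∀ r → F [ r , j ] < F [ r , c ]
  rows-< zero    eq r = row-step eq r
  rows-< (suc d) {j} {c} eq r with b , eq-b ← predecessor c eq =
    <-trans (rows-< d eq-b r) (row-step (trans eq (cong suc (sym eq-b))) r)

  -- z lies strictly between x and y, whichever of the two is larger.
  Between : ℕ → ℕ → ℕ → Set
  Between z x y = x < z × z < y ⊎ y < z × z < x

  -- If no entry of column c separates the two cells, they lie in the same gap of
  -- column c.  It is an inner gap: the entry x in column c′ exceeds the entry of
  -- its own row in column c, and the entry y in column j is less than that of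
  -- its own row.
  interpolate-or-gap : ∀ d {j c c′} → toℕ c ≡ suc (d + toℕ j) → Consecutive c c′ → ∀ r s →
    (∃ λ z → Between (F [ z , c ]) (F [ r , j ]) (F [ s , c′ ])) ⊎
    (∃₂ λ i i′ → Consecutive i i′ × (F [ i , c ] < F [ r , j ] × F [ r , j ] < F [ i′ , c ])
                                  × (F [ i , c ] < F [ s , c′ ] × F [ s , c′ ] < F [ i′ , c ]))
  interpolate-or-gap d {j} {c} {c′} eq cons r s
    with any? (λ z → (F [ r , j ] <? F [ z , c ]) ×-dec (F [ z , c ] <? F [ s , c′ ])
               ⊎-dec (F [ s , c′ ] <? F [ z , c ]) ×-dec (F [ z , c ] <? F [ r , j ]))
  ... | yes found = inj₁ found
  ... | no  none  = inj₂ gap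
    where
    x = F [ s , c′ ]
    y = F [ r , j ]

    ≢y : ∀ z → F [ z , c ] ≢ y
    ≢y z e = m≢1+n+m (toℕ c)
      (trans eq (cong (λ l → suc (d + toℕ l)) (sym (proj₂ (distinct-F {z} {c} {r} {j} e)))))

    ≢x : ∀ z → F [ z , c ] ≢ x
    ≢x z e = m≢1+n+m (toℕ c) {0} (trans (cong toℕ (proj₂ (distinct-F {z} {c} {s} {c′} e))) cons)

    x<upper : ∀ {z} → ¬ F [ z , c ] < x → x < F [ z , c ]
    x<upper {z} z≮x = ≤∧≢⇒< (≮⇒≥ z≮x) (≢x z ∘ sym)

    above-lower : ∀ {z} → F [ z , c ] < x → F [ z , c ] < y
    above-lower {z} z<x = ≤∧≢⇒< (≮⇒≥ λ lt → none (z , inj₁ (lt , z<x))) (≢y z)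

    below-upper : ∀ {z} → x < F [ z , c ] → y < F [ z , c ]
    below-upper {z} x<z = ≤∧≢⇒< (≮⇒≥ λ lt → none (z , inj₂ (x<z , lt))) (≢y z ∘ sym)

    s-below : F [ s , c ] < x
    s-below = row-step cons s

    r-above : x < F [ r , c ]
    r-above = x<upper λ lt → none (r , inj₁ (rows-< d eq r , lt))

    gap : ∃₂ λ i i′ → Consecutive i i′ × (F [ i , c ] < y × y < F [ i′ , c ])
                                       × (F [ i , c ] < x × x < F [ i′ , c ])
    gap with i , i′ , succ , _ , _ , i<x , i′≮x ← step-between (λ i → F [ i , c ] <? x)
           (<⇒≤ (column-reflects-< {F = F} inc-F {j = c} (<-trans s-below r-above))) s-below (<-asym r-above) =
      i , i′ , succ , (above-lower i<x , below-upper (x<upper i′≮x)) , (i<x , x<upper i′≮x)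

  private
    no-gap : ∀ {a b z} → a + 1 ≡ b → a < z → ¬ z < b
    no-gap {a} {z = z} refl a<z z<b = <⇒≱ z<b (subst (_≤ z) (+-comm 1 a) a<z)

  mutual

    -- In a gap of column c with an entry of column c′ and one of a column to the
    -- left, neither of the two equations of degeneracy can hold.
    interpolate : Degenerate P → ∀ d {j c c′} → toℕ c ≡ suc (d + toℕ j) → Consecutive c c′ →
      ∀ r s → ∃ λ z → Between (F [ z , c ]) (F [ r , j ]) (F [ s , c′ ])
    interpolate deg d {j} {c} {c′} eq cons r s with interpolate-or-gap d {j} {c} {c′} eq cons r s
    ... | inj₁ found = found
    ... | inj₂ (i , i′ , succ , y-gap , (i<x , x<i′)) with deg i i′ succ
    ...   | inj₁ e = contradiction (to-pattern cons {s} {i′} 1F 0F x<i′)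
                       (no-gap e (to-pattern cons {i} {s} 0F 1F i<x))
    ...   | inj₂ e with b , b-c , z , i<z , z<i′ ← previous deg d eq y-gap =
      contradiction (to-pattern b-c {z} {i′} 0F 1F z<i′) (no-gap e (to-pattern b-c {i} {z} 1F 0F i<z))

    -- A gap of column c that contains an entry of some column j to the left
    -- contains one of the column b immediately to the left.
    previous : Degenerate P → ∀ d {j c} → toℕ c ≡ suc (d + toℕ j) → ∀ {r i i′} →
      F [ i , c ] < F [ r , j ] × F [ r , j ] < F [ i′ , c ] →
      ∃ λ b → Consecutive b c × ∃ λ z → F [ i , c ] < F [ z , b ] × F [ z , b ] < F [ i′ , c ]
    previous deg zero    {j} eq {r} gap = j , eq , r , gap
    previous deg (suc d) {j} {c} eq {r} {i} (i<y , y<i′)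
      with b , eq-b ← predecessor c eq
      with b-c ← trans eq (cong suc (sym eq-b))
      with interpolate deg d {j} {b} {c} eq-b b-c r i
    ... | z , inj₁ (y<z , z<i) = contradiction (<-trans y<z z<i) (<-asym i<y)
    ... | z , inj₂ (i<z , z<y) = b , b-c , z , i<z , <-trans z<y y<i′

-- Uniqueness for degenerate patterns

module _ {P : Array k 2} (standard : IsStandard P) (deg : Degenerate P)
         {F G : Array k n} (full-F : IsFull P F) (full-G : IsFull P G) where

  private
    module F = Full standard full-F
    module G = Full standard full-G

  -- For columns further apart an interpolating entry z decides the comparison,
  -- in F and, since its own comparisons transfer, in G.
  apart-⊑ : ∀ d {j c} → toℕ c ≡ suc (d + toℕ j) → ∀ r s →
    (F [ r , j ] < F [ s , c ] → G [ r , j ] < G [ s , c ]) ×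
    (F [ s , c ] < F [ r , j ] → G [ s , c ] < G [ r , j ])
  apart-⊑ zero    eq r s =
      (λ lt → G.from-pattern eq {r} {s} 0F 1F (F.to-pattern eq {r} {s} 0F 1F lt))
    , (λ lt → G.from-pattern eq {s} {r} 1F 0F (F.to-pattern eq {s} {r} 1F 0F lt))
  apart-⊑ (suc d) {j} {c} eq r s with b , eq-b ← F.predecessor c eq
    with F.interpolate deg d {j} {b} {c} eq-b (trans eq (cong suc (sym eq-b))) r s
       | trans eq (cong suc (sym eq-b))
  ... | z , inj₁ (r<z , z<s) | b-c =
      (λ _ → <-trans (proj₁ (apart-⊑ d eq-b r z) r<z)
                     (G.from-pattern b-c {z} {s} 0F 1F (F.to-pattern b-c {z} {s} 0F 1F z<s)))
    , (λ lt → contradiction (<-trans r<z z<s) (<-asym lt))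
  ... | z , inj₂ (s<z , z<r) | b-c =
      (λ lt → contradiction (<-trans s<z z<r) (<-asym lt))
    , (λ _ → <-trans (G.from-pattern b-c {s} {z} 1F 0F (F.to-pattern b-c {s} {z} 1F 0F s<z))
                     (proj₂ (apart-⊑ d eq-b r z) z<r))

  private
    distance : ∀ {a b} → a < b → b ≡ suc (b ∸ suc a + a)
    distance {a} a<b = sym (trans (sym (+-suc _ a)) (m∸n+n≡m a<b))

  full-⊑ : F ⊑ G
  full-⊑ r j s c lt with <-cmp (toℕ j) (toℕ c)
  ... | tri< j<c _ _ = proj₁ (apart-⊑ (toℕ c ∸ suc (toℕ j)) (distance j<c) r s) lt
  ... | tri> _ _ c<j = proj₂ (apart-⊑ (toℕ j ∸ suc (toℕ c)) (distance c<j) s r) lt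
  ... | tri≈ _ eq _ with refl ← toℕ-injective eq =
    G.inc-F r s j (column-reflects-< {F = F} F.inc-F {j = j} lt)

  full-unique : F ≡ G
  full-unique = begin
    F     ≡⟨ eachOnce⇒red F F.once-F ⟨
    red F ≡⟨ red-cong (λ {i} {j} → F.distinct-F {i} {j}) full-⊑ ⟩
    red G ≡⟨ eachOnce⇒red G G.once-F ⟩
    G     ∎
    where open ≡-Reasoning

-- Exchanging adjacent values

-- The transposition of v and suc v.
exchange : ℕ → ℕ → ℕ
exchange v x with x ≟ v | x ≟ suc v
... | yes _ | _     = suc v
... | no  _ | yes _ = v
... | no  _ | no  _ = x

exchange-injective : ∀ v {x y} → exchange v x ≡ exchange v y → x ≡ y
exchange-injective v {x} {y} eq with x ≟ v | x ≟ suc v | y ≟ v | y ≟ suc v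
... | yes refl | _        | yes refl | _        = refl
... | yes refl | _        | no _     | yes refl = contradiction (sym eq) (m≢1+n+m v {0})
... | yes refl | _        | no _     | no ne    = contradiction (sym eq) ne
... | no _     | yes refl | yes refl | _        = contradiction eq (m≢1+n+m v {0})
... | no _     | yes refl | no _     | yes refl = refl
... | no _     | yes refl | no ne    | no _     = contradiction (sym eq) ne
... | no _     | no ne    | yes refl | _        = contradiction eq ne
... | no ne    | no _     | no _     | yes refl = contradiction eq ne
... | no _     | no _     | no _     | no _     = eq

exchange-mono : ∀ v {x y} → x < y → ¬ (x ≡ v × y ≡ suc v) → exchange v x < exchange v y
exchange-mono v {x} {y} x<y other with x ≟ v | x ≟ suc v | y ≟ v | y ≟ suc v
... | yes refl | _        | yes refl | _        = contradiction x<y (<-irrefl refl)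
... | yes refl | _        | no _     | yes refl = contradiction (refl , refl) other
... | yes refl | _        | no _     | no ne    = ≤∧≢⇒< x<y (ne ∘ sym)
... | no _     | yes refl | yes refl | _        = contradiction x<y (<-asym (n<1+n v))
... | no _     | yes refl | no _     | yes refl = contradiction x<y (<-irrefl refl)
... | no _     | yes refl | no _     | no _     = <-trans (n<1+n v) x<y
... | no _     | no _     | yes refl | _        = m<n⇒m<1+n x<y
... | no ne    | no _     | no _     | yes refl = ≤∧≢⇒< (s≤s⁻¹ x<y) ne
... | no _     | no _     | no _     | no _     = x<y

exchange-swaps : ∀ v → exchange v (suc v) < exchange v v
exchange-swaps v with suc v ≟ v | suc v ≟ suc v | v ≟ v | v ≟ suc v
... | yes eq | _      | _      | _ = contradiction (sym eq) (m≢1+n+m v {0})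
... | no  _  | no ne  | _      | _ = contradiction refl ne
... | no  _  | yes _  | no ne  | _ = contradiction refl ne
... | no  _  | yes _  | yes _  | _ = n<1+n v

module _ {P : Array k 2} (standard : IsStandard P) {F : Array k n} (full-F : IsFull P F) where

  private
    module F = Full standard full-F

  -- If the cells with values v and suc v are in different columns that are not
  -- neighbours, no condition on full fillings compares them.
  swapped : ∀ {s p r q} → F [ r , q ] ≡ suc (F [ s , p ]) →
    p ≢ q → ¬ Consecutive p q → ¬ Consecutive q p → ∃ λ G → IsFull P G × G ≢ F
  swapped {s} {p} {r} {q} eq p≢q ¬pq ¬qp = red H , realises⇒full (proj₁ standard) real , red-H≢F
    where
    v = F [ s , p ]

    H : Array k n
    H = Vec.map (Vec.map (exchange v)) F

    H-lookup : ∀ i j → H [ i , j ] ≡ exchange v (F [ i , j ])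
    H-lookup i j = trans (cong (λ row → lookup row j) (lookup-map i _ F)) (lookup-map j _ (lookup F i))

    H-mono : ∀ i j i′ j′ → (j ≡ p → j′ ≢ q) →
      F [ i , j ] < F [ i′ , j′ ] → H [ i , j ] < H [ i′ , j′ ]
    H-mono i j i′ j′ other lt = subst₂ _<_ (sym (H-lookup i j)) (sym (H-lookup i′ j′))
      (exchange-mono v lt λ { (e , e′) →
        other (proj₂ (F.distinct-F {i} {j} {s} {p} e))
              (proj₂ (F.distinct-F {i′} {j′} {r} {q} (trans e′ (sym eq)))) })

    real : Realises P H
    real = record
      { distinct = λ {i} {j} {i′} {j′} e → F.distinct-F {i} {j} {i′} {j′}
          (exchange-injective v (trans (sym (H-lookup i j)) (trans e (H-lookup i′ j′))))
      ; increase = inc-H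
      ; embeds   = λ j j′ cons → embeds-columns {P = P} {H} (proj₂ (proj₁ standard)) inc-H
          (λ i i′ lt → H-mono i j i′ j′ (λ { refl refl → ¬pq cons }) (F.from-pattern cons {i} {i′} 0F 1F lt))
          (λ i i′ lt → H-mono i′ j′ i j (λ { refl refl → ¬qp cons }) (F.from-pattern cons {i′} {i} 1F 0F lt))
      }
      where
      inc-H : ColumnsIncrease H
      inc-H i i′ j i<i′ = H-mono i j i′ j (λ { refl refl → p≢q refl }) (F.inc-F i i′ j i<i′)

    red-H≢F : red H ≢ F
    red-H≢F e = <-asym (n<1+n v) (subst₂ _<_ eq refl
      (subst (λ G → G [ r , q ] < G [ s , p ]) e (⊑-red H r q s p
        (subst₂ _<_ (sym (trans (H-lookup r q) (cong (exchange v) eq))) (sym (H-lookup s p))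
          (exchange-swaps v)))))

-- Nondegenerate patterns and three columns

-- The entry suc (P [ i , c ]) of P lies in the gap of column c between rows i
-- and i′; it cannot stand in column c, where nothing lies between these rows.
gap-entry : {P : Array k 2} → IsFilling P → ∀ {i i′} → Consecutive i i′ →
  ∀ c → P [ i , c ] + 1 ≢ P [ i′ , c ] →
  ∃₂ λ r c′ → P [ i , c ] < P [ r , c′ ] × P [ r , c′ ] < P [ i′ , c ] × c′ ≢ c
gap-entry {k = k} {P} (once-P , inc-P) {i} {i′} succ c ≢c
  with w , eq-w ← eachOnce⇒entry P once-P i′ c =
  next (eachOnce⇒cell P once-P (fromℕ< i<2k))
  where
  i<i′ : P [ i , c ] < P [ i′ , c ]
  i<i′ = inc-P i i′ c (≤-reflexive (sym succ))

  i<2k : P [ i , c ] < k * 2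
  i<2k = <-≤-trans i<i′ (subst (_≤ k * 2) (sym eq-w) (toℕ<n w))

  next : (∃₂ λ r c′ → P [ r , c′ ] ≡ suc (toℕ (fromℕ< i<2k))) →
    ∃₂ λ r c′ → P [ i , c ] < P [ r , c′ ] × P [ r , c′ ] < P [ i′ , c ] × c′ ≢ c
  next (r , c′ , eq) = r , c′ , i<r , r<i′ , λ { refl →
      <⇒≱ (column-reflects-< {F = P} inc-P {r} {i′} {c} r<i′)
        (subst (_≤ toℕ r) (sym succ) (column-reflects-< {F = P} inc-P {i} {r} {c} i<r)) }
    where
    eq′ : P [ r , c′ ] ≡ suc (P [ i , c ])
    eq′ = trans eq (cong suc (toℕ-fromℕ< i<2k))

    i<r : P [ i , c ] < P [ r , c′ ]
    i<r = ≤-reflexive (sym eq′)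

    r<i′ : P [ r , c′ ] < P [ i′ , c ]
    r<i′ = ≤∧≢⇒< (subst (_≤ _) (sym eq′) i<i′) λ e → ≢c (trans (+-comm _ 1) (trans (sym eq′) e))

outer-separated : ∀ {p q : Fin 3} → p ≢ 1F → q ≢ 1F → ¬ Consecutive p q
outer-separated {0F} {1F} _    q≢1 _ = q≢1 refl
outer-separated {1F} {2F} p≢1 _    _ = p≢1 refl

module _ {P : Array k 2} (standard : IsStandard P) {F : Array k 3} (full-F : IsFull P F) where

  private
    module F = Full standard full-F

    cell : ∀ v → ∃₂ λ i j → F [ i , j ] ≡ suc (toℕ v)
    cell = eachOnce⇒cell F F.once-F

    row-of : Fin (k * 3) → Fin k
    row-of v = proj₁ (cell v)

    column-of : Fin (k * 3) → Fin 3
    column-of v = proj₁ (proj₂ (cell v))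

    value-of : ∀ v → F [ row-of v , column-of v ] ≡ suc (toℕ v)
    value-of v = proj₂ (proj₂ (cell v))

  module Gap (i i′ : Fin k) (succ : Consecutive i i′) where

    -- The gap of the middle column between rows i and i′.
    In-gap : ℕ → Set
    In-gap x = F [ i , 1F ] < x × x < F [ i′ , 1F ]

    gap-avoids-1F : ∀ {r q} → In-gap (F [ r , q ]) → q ≢ 1F
    gap-avoids-1F {r} (lt , lt′) refl = <⇒≱ (column-reflects-< {F = F} F.inc-F {r} {i′} {1F} lt′)
      (subst (_≤ toℕ r) (sym succ) (column-reflects-< {F = F} F.inc-F {i} {r} {1F} lt))

    adjacent⇒another : ∀ {v v′} → Consecutive v v′ → column-of v ≢ column-of v′ →
      F [ i , 1F ] < suc (toℕ v) → suc (toℕ v′) < F [ i′ , 1F ] → ∃ λ G → IsFull P G × G ≢ F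
    adjacent⇒another {v} {v′} v-v′ differ i<v v′<i′ =
      swapped standard full-F {row-of v} {column-of v} {row-of v′} {column-of v′}
        (trans (value-of v′) (cong suc (trans v-v′ (sym (value-of v)))))
        differ (outer-separated v-outer v′-outer) (outer-separated v′-outer v-outer)
      where
      v<v′ : suc (toℕ v) < suc (toℕ v′)
      v<v′ = s≤s (≤-reflexive (sym v-v′))

      v-outer : column-of v ≢ 1F
      v-outer = gap-avoids-1F {row-of v} (subst In-gap (sym (value-of v)) (i<v , <-trans v<v′ v′<i′))

      v′-outer : column-of v′ ≢ 1F
      v′-outer = gap-avoids-1F {row-of v′} (subst In-gap (sym (value-of v′)) (<-trans i<v v<v′ , v′<i′))

    -- Between the two given values, the column of the current value leaves p at
    -- some step from v to v′; all values involved lie in the gap.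
    another : ∀ {s p r q} → p ≢ q → In-gap (F [ s , p ]) → In-gap (F [ r , q ]) →
      F [ s , p ] < F [ r , q ] → ∃ λ G → IsFull P G × G ≢ F
    another {s} {p} {r} {q} p≢q (i<s , _) (_ , r<i′) s<r =
      from-entries (eachOnce⇒entry F F.once-F s p) (eachOnce⇒entry F F.once-F r q)
      where
      column-unique : ∀ {v t l} → F [ t , l ] ≡ suc (toℕ v) → column-of v ≡ l
      column-unique {v} {t} {l} eq =
        proj₂ (F.distinct-F {row-of v} {column-of v} {t} {l} (trans (value-of v) (sym eq)))

      from-entries : (∃ λ u → F [ s , p ] ≡ suc (toℕ u)) → (∃ λ w → F [ r , q ] ≡ suc (toℕ w)) →
        ∃ λ G → IsFull P G × G ≢ F
      from-entries (u , eq-u) (w , eq-w) = from-step (step-between (λ v → column-of v Fin.≟ p)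
          (<⇒≤ (s≤s⁻¹ (subst₂ _<_ eq-u eq-w s<r)))
          (column-unique eq-u) λ e → p≢q (trans (sym e) (column-unique eq-w)))
        where
        from-step : (∃₂ λ v v′ → Consecutive v v′ × u Fin.≤ v × v′ Fin.≤ w ×
                      column-of v ≡ p × column-of v′ ≢ p) → ∃ λ G → IsFull P G × G ≢ F
        from-step (v , v′ , v-v′ , u≤v , v′≤w , at-p , off-p) =
          adjacent⇒another v-v′ (λ e → off-p (trans (sym e) at-p))
            (<-≤-trans (subst (_ <_) eq-u i<s) (s≤s u≤v))
            (≤-<-trans (s≤s v′≤w) (subst (_< _) eq-w r<i′))

  nondegenerate⇒another : ∀ i i′ → Consecutive i i′ →
    P [ i , 0F ] + 1 ≢ P [ i′ , 0F ] → P [ i , 1F ] + 1 ≢ P [ i′ , 1F ] →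
    ∃ λ G → IsFull P G × G ≢ F
  nondegenerate⇒another i i′ succ ≢0 ≢1 =
    from-gap (left-entry (gap-entry {P = P} (proj₁ standard) succ 1F ≢1))
             (right-entry (gap-entry {P = P} (proj₁ standard) succ 0F ≢0))
    where
    open Gap i i′ succ

    left-entry : (∃₂ λ s c → P [ i , 1F ] < P [ s , c ] × P [ s , c ] < P [ i′ , 1F ] × c ≢ 1F) →
      ∃ λ s → In-gap (F [ s , 0F ])
    left-entry (_ , 1F , _ , _ , ≢1)     = contradiction refl ≢1
    left-entry (s , 0F , i<s , s<i′ , _) =
      s , F.from-pattern {0F} {1F} refl {i} {s} 1F 0F i<s , F.from-pattern {0F} {1F} refl {s} {i′} 0F 1F s<i′

    right-entry : (∃₂ λ r c → P [ i , 0F ] < P [ r , c ] × P [ r , c ] < P [ i′ , 0F ] × c ≢ 0F) →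
      ∃ λ r → In-gap (F [ r , 2F ])
    right-entry (_ , 0F , _ , _ , ≢0)     = contradiction refl ≢0
    right-entry (r , 1F , i<r , r<i′ , _) =
      r , F.from-pattern {1F} {2F} refl {i} {r} 0F 1F i<r , F.from-pattern {1F} {2F} refl {r} {i′} 1F 0F r<i′

    from-gap : (∃ λ s → In-gap (F [ s , 0F ])) → (∃ λ r → In-gap (F [ r , 2F ])) →
      ∃ λ G → IsFull P G × G ≢ F
    from-gap (s , s-gap) (r , r-gap) = by-order (<-cmp (F [ s , 0F ]) (F [ r , 2F ]))
      where
      by-order : Tri (F [ s , 0F ] < F [ r , 2F ]) (F [ s , 0F ] ≡ F [ r , 2F ]) (F [ r , 2F ] < F [ s , 0F ]) →
        ∃ λ G → IsFull P G × G ≢ F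
      by-order (tri< lt _ _) = another {s} {0F} {r} {2F} (λ ()) s-gap r-gap lt
      by-order (tri≈ _ eq _) = contradiction (proj₂ (F.distinct-F {s} {0F} {r} {2F} eq)) λ ()
      by-order (tri> _ _ gt) = another {r} {2F} {s} {0F} (λ ()) r-gap s-gap gt

-- Counting full fillings

unique-length : {xs : List A} → Unique xs → ∀ {x} → x ∈ xs → (∀ {y} → y ∈ xs → y ≡ x) →
  List.length xs ≡ 1
unique-length {xs = _ List.∷ List.[]}     _ _ _ = refl
unique-length {xs = _ List.∷ _ List.∷ _} ((y≢z ∷ _) ∷ _) _ only =
  contradiction (trans (only (here refl)) (sym (only (there (here refl))))) y≢z

length-1 : {xs : List A} → List.length xs ≡ 1 → ∀ {x y} → x ∈ xs → y ∈ xs → x ≡ y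
length-1 {xs = _ List.∷ List.[]} _ (here refl) (here refl) = refl

vectors-unique : {xs : List A} → Unique xs → ∀ n → Unique (vectors xs n)
vectors-unique uniq zero    = [] ∷ []
vectors-unique uniq (suc n) = Unique.cartesianProductWith⁺ _∷_ ∷-injective uniq (vectors-unique uniq n)

∈-vectors : {xs : List A} (v : Vec A n) → (∀ i → lookup v i ∈ xs) → v ∈ vectors xs n
∈-vectors []      _   = here refl
∈-vectors (x ∷ v) all = ∈-cartesianProductWith⁺ _∷_ (all zero) (∈-vectors v (all ∘ suc))

arrays-unique : ∀ k n → Unique (arrays k n)
arrays-unique k n = vectors-unique (vectors-unique
  (Unique.map⁺ suc-injective (Unique.upTo⁺ (k * n))) n) k

∈-arrays : {F : Array k n} → EachOnce F → F ∈ arrays k n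
∈-arrays {F = F} once = ∈-vectors F λ i → ∈-vectors (lookup F i) λ j →
  let v , eq = eachOnce⇒entry F once i j in
  subst (_∈ _) (sym eq) (∈-map⁺ suc (∈-upTo⁺ (toℕ<n v)))

-- The list whose length is full P n when n is not 1.
fulls : Array k 2 → ∀ n → List (Array k n)
fulls {k} P n = List.filter (isFull? P) (arrays k n)

∈-fulls : {P : Array k 2} {F : Array k n} → IsFull P F → F ∈ fulls P n
∈-fulls {P = P} full-F = ∈-filter⁺ (isFull? P) (∈-arrays (proj₁ (proj₁ full-F))) full-F

full-exists : {P : Array k 2} → IsStandard P → ∀ n → ∃ λ (F : Array k (suc n)) → IsFull P F
full-exists standard n with F , real ← Prepend.realisation standard n =
  red F , realises⇒full (proj₁ standard) real

nonunique⇒full-3≢1 : {P : Array k 2} {F : Array k 3} → IsFull P F →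
  (∃ λ G → IsFull P G × G ≢ F) → full P 3 ≢ 1
nonunique⇒full-3≢1 {P = P} {F} full-F (G , full-G , G≢F) eq =
  G≢F (length-1 eq (∈-fulls {P = P} {G} full-G) (∈-fulls {P = P} {F} full-F))

unique⇒full≡1 : {P : Array k 2} {F : Array k (suc (suc n))} → IsFull P F →
  (∀ {G} → IsFull P G → G ≡ F) → full P (suc (suc n)) ≡ 1
unique⇒full≡1 {k = k} {n = n} {P} {F} full-F only =
  unique-length (Unique.filter⁺ (isFull? P) (arrays-unique k (suc (suc n)))) (∈-fulls {P = P} {F} full-F)
    λ {G} G∈ → only (proj₂ (∈-filter⁻ (isFull? P) {xs = arrays k (suc (suc n))} G∈))

theorem13 : ∀ (k : ℕ) → k ≥ 2 → (P : Array k 2) → IsStandard P →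
    (∀ (n : ℕ) → n ≥ 1 → full P n ≡ 1) ⇔ Degenerate P
theorem13 k k≥2 P standard = mk⇔ degenerate single
  where
  degenerate : (∀ n → n ≥ 1 → full P n ≡ 1) → Degenerate P
  degenerate unique i i′ succ = by-gaps
    (P [ i , 0F ] + 1 ≟ P [ i′ , 0F ]) (P [ i , 1F ] + 1 ≟ P [ i′ , 1F ])
    where
    by-gaps : Dec (P [ i , 0F ] + 1 ≡ P [ i′ , 0F ]) → Dec (P [ i , 1F ] + 1 ≡ P [ i′ , 1F ]) →
      P [ i , 0F ] + 1 ≡ P [ i′ , 0F ] ⊎ P [ i , 1F ] + 1 ≡ P [ i′ , 1F ]
    by-gaps (yes eq) _        = inj₁ eq
    by-gaps (no _)   (yes eq) = inj₂ eq
    by-gaps (no ≢0)  (no ≢1)  =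
      let F , full-F = full-exists standard 2 in
      contradiction (unique 3 (s≤s z≤n)) (nonunique⇒full-3≢1 {P = P} {F} full-F
        (nondegenerate⇒another standard {F} full-F i i′ succ ≢0 ≢1))

  single : Degenerate P → ∀ n → n ≥ 1 → full P n ≡ 1
  single deg 1             _ = refl
  single deg (suc (suc n)) _ =
    let F , full-F = full-exists standard (suc n) in
    unique⇒full≡1 {P = P} {F} full-F λ {G} full-G → full-unique standard deg {G} {F} full-G full-F
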